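{- Let $(\Omega,\leftarrow,\rightarrow,\triangleleft,\triangleright)$ be a nondegenerate extended diassociative semigroup (EDS), with bijections $\varphi_\leftarrow(\alpha,\beta)=(\alpha\leftarrow\beta,\alpha\triangleleft\beta)$ and $\varphi_\rightarrow(\alpha,\beta)=(\alpha\rightarrow\beta,\alpha\triangleright\beta)$ of $\Omega^2$. Define four products $\curvearrowleft,\curvearrowright,\blacktriangleleft,\blacktriangleright$ on $\Omega$ by: for all $\alpha,\beta\in\Omega$, $$\varphi_\leftarrow^{ -1}(\alpha,\beta)=(\alpha\curvearrowleft\beta,\alpha\blacktriangleleft\beta),\qquad\varphi_\rightarrow^{ -1}(\alpha,\beta)=(\beta\blacktriangleright\alpha,\beta\curvearrowright\alpha).$$ Then, for all $\alpha,\beta,\gamma\in\Omega$: - $(\alpha\curvearrowright\beta)\curvearrowleft\gamma=\alpha\curvearrowright(\beta\curvearrowleft\gamma)$; - $\alpha\blacktriangleleft(\beta\blacktriangleleft\gamma)=(\alpha\blacktriangleleft\beta)\blacktriangleleft\gamma$ and $(\alpha\blacktriangleright\beta)\blacktriangleright\gamma=\alpha\blacktriangleright(\beta\blacktriangleright\gamma)$; - $\alpha\blacktriangleright(\beta\curvearrowleft\gamma)=\alpha\blacktriangleright\beta$ and $(\alpha\curvearrowright\beta)\blacktriangleleft\gamma=\beta\blacktriangleleft\gamma$; - $(\alpha\curvearrowleft(\beta\blacktriangleleft\gamma))\curvearrowleft(\beta\curvearrowleft\gamma)=\alpha\curvearrowleft\beta$ and $(\alpha\curvearrowright\beta)\curvearrowright((\alpha\blacktriangleright\beta)\curvearrowright\gamma)=\beta\curvearrowright\gamma$;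 - $(\alpha\curvearrowleft(\beta\blacktriangleleft\gamma))\blacktriangleleft(\beta\curvearrowleft\gamma)=(\alpha\blacktriangleleft\beta)\curvearrowleft\gamma$ and $(\alpha\curvearrowright\beta)\blacktriangleright((\alpha\blacktriangleright\beta)\curvearrowright\gamma)=\alpha\curvearrowright(\beta\blacktriangleright\gamma)$; - $(\alpha\curvearrowleft(\beta\curvearrowright\gamma))\curvearrowleft(\beta\blacktriangleright\gamma)=\alpha\curvearrowleft\gamma$ and $(\alpha\blacktriangleleft\beta)\curvearrowright((\alpha\curvearrowleft\beta)\curvearrowright\gamma)=\alpha\curvearrowright\gamma$; - $(\alpha\curvearrowleft(\beta\curvearrowright\gamma))\blacktriangleleft(\beta\blacktriangleright\gamma)=\beta\blacktriangleright(\alpha\blacktriangleleft\gamma)$ and $(\alpha\blacktriangleleft\beta)\blacktriangleright((\alpha\curvearrowleft\beta)\curvearrowright\gamma)=(\alpha\blacktriangleright\gamma)\blacktriangleleft\beta$; - $(\alpha\curvearrowleft\beta)\blacktriangleright\gamma=(\alpha\blacktriangleright\gamma)\curvearrowleft\beta$ and $\beta\curvearrowright(\alpha\blacktriangleleft\gamma)=\alpha\blacktriangleleft(\beta\curvearrowright\gamma)$. In particular, $\blacktriangleleft$ and $\blacktriangleright$ are associative.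
   Context: Extended diassociative semigroups. A diassociative semigroup is a set $\Omega$ with maps $\leftarrow,\rightarrow:\Omega\times\Omega\to\Omega$ such that for all $\alpha,\beta,\gamma\in\Omega$: $(\alpha\leftarrow\beta)\leftarrow\gamma=\alpha\leftarrow(\beta\leftarrow\gamma)=\alpha\leftarrow(\beta\rightarrow\gamma)$; $(\alpha\rightarrow\beta)\leftarrow\gamma=\alpha\rightarrow(\beta\leftarrow\gamma)$; $(\alpha\rightarrow\beta)\rightarrow\gamma=(\alpha\leftarrow\beta)\rightarrow\gamma=\alpha\rightarrow(\beta\rightarrow\gamma)$. An extended diassociative semigroup (EDS) is $(\Omega,\leftarrow,\rightarrow,\triangleleft,\triangleright)$ such that $(\Omega,\leftarrow,\rightarrow)$ is a diassociative semigroup and for all $\alpha,\beta,\gamma\in\Omega$: $\alpha\triangleright(\beta\leftarrow\gamma)=\alpha\triangleright\beta$; $(\alpha\rightarrow\beta)\triangleleft\gamma=\beta\triangleleft\gamma$; $(\alpha\triangleleft\beta)\leftarrow((\alpha\leftarrow\beta)\triangleleft\gamma)=\alpha\triangleleft(\beta\leftarrow\gamma)$; $(\alpha\triangleleft\beta)\triangleleft((\alpha\leftarrow\beta)\triangleleft\gamma)=\beta\triangleleft\gamma$; $(\alpha\triangleleft\beta)\rightarrow((\alpha\leftarrow\beta)\triangleleft\gamma)=\alpha\triangleleft(\beta\rightarrow\gamma)$; $(\alpha\triangleleft\beta)\triangleright((\alpha\leftarrow\beta)\triangleleft\gamma)=\beta\triangleright\gamma$; $(\alpha\triangleright(\beta\rightarrow\gamma))\leftarrow(\beta\triangleright\gamma)=(\alpha\leftarrow\beta)\triangleright\gamma$;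 $(\alpha\triangleright(\beta\rightarrow\gamma))\triangleleft(\beta\triangleright\gamma)=\alpha\triangleleft\beta$; $(\alpha\triangleright(\beta\rightarrow\gamma))\rightarrow(\beta\triangleright\gamma)=(\alpha\rightarrow\beta)\triangleright\gamma$; $(\alpha\triangleright(\beta\rightarrow\gamma))\triangleright(\beta\triangleright\gamma)=\alpha\triangleright\beta$. It is nondegenerate if the maps $\varphi_\leftarrow,\varphi_\rightarrow:\Omega^2\to\Omega^2$ given in the claim are bijective. -}

module Defs where

open import Data.Product using (_×_; _,_; proj₁; proj₂)
open import Function.Bundles using (Inverse; mk⤖)
open import Function.Definitions using (Bijective)
open import Function.Properties.Bijection using (⤖⇒↔)
open import Level using (Level; suc)
open import Relation.Binary.PropositionalEquality using (_≡_)

-- Since → is reserved in Agda, the products ← and → are written ⟵ and ⟶.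
record DiassociativeSemigroup (a : Level) : Set (suc a) where
  infix 7 _⟵_ _⟶_
  field
    Ω       : Set a
    _⟵_ _⟶_ : Ω → Ω → Ω

    ⟵-assoc   : ∀ α β γ → (α ⟵ β) ⟵ γ ≡ α ⟵ (β ⟵ γ)
    ⟵-inner   : ∀ α β γ → α ⟵ (β ⟵ γ) ≡ α ⟵ (β ⟶ γ)
    ⟶-⟵-assoc : ∀ α β γ → (α ⟶ β) ⟵ γ ≡ α ⟶ (β ⟵ γ)
    ⟶-inner   : ∀ α β γ → (α ⟶ β) ⟶ γ ≡ (α ⟵ β) ⟶ γ
    ⟶-assoc   : ∀ α β γ → (α ⟵ β) ⟶ γ ≡ α ⟶ (β ⟶ γ)

record ExtendedDiassociativeSemigroup (a : Level) : Set (suc a) where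
  field
    diassociativeSemigroup : DiassociativeSemigroup a

  open DiassociativeSemigroup diassociativeSemigroup public

  infix 7 _◁_ _▷_
  field
    _◁_ _▷_ : Ω → Ω → Ω

    ▷-⟵ : ∀ α β γ → α ▷ (β ⟵ γ) ≡ α ▷ β
    ⟶-◁ : ∀ α β γ → (α ⟶ β) ◁ γ ≡ β ◁ γ

    ◁-⟵-◁ : ∀ α β γ → (α ◁ β) ⟵ ((α ⟵ β) ◁ γ) ≡ α ◁ (β ⟵ γ)
    ◁-◁-◁ : ∀ α β γ → (α ◁ β) ◁ ((α ⟵ β) ◁ γ) ≡ β ◁ γ
    ◁-⟶-◁ : ∀ α β γ → (α ◁ β) ⟶ ((α ⟵ β) ◁ γ) ≡ α ◁ (β ⟶ γ)
    ◁-▷-◁ : ∀ α β γ → (α ◁ β) ▷ ((α ⟵ β) ◁ γ) ≡ β ▷ γ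

    ▷-⟵-▷ : ∀ α β γ → (α ▷ (β ⟶ γ)) ⟵ (β ▷ γ) ≡ (α ⟵ β) ▷ γ
    ▷-◁-▷ : ∀ α β γ → (α ▷ (β ⟶ γ)) ◁ (β ▷ γ) ≡ α ◁ β
    ▷-⟶-▷ : ∀ α β γ → (α ▷ (β ⟶ γ)) ⟶ (β ▷ γ) ≡ (α ⟶ β) ▷ γ
    ▷-▷-▷ : ∀ α β γ → (α ▷ (β ⟶ γ)) ▷ (β ▷ γ) ≡ α ▷ β

  φ⟵ φ⟶ : Ω × Ω → Ω × Ω
  φ⟵ (α , β) = α ⟵ β , α ◁ β
  φ⟶ (α , β) = α ⟶ β , α ▷ β

record Nondegenerate {a} (E : ExtendedDiassociativeSemigroup a) : Set a where
  open ExtendedDiassociativeSemigroup E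
  field
    φ⟵-bijective : Bijective _≡_ _≡_ φ⟵
    φ⟶-bijective : Bijective _≡_ _≡_ φ⟶

  φ⟵⁻¹ φ⟶⁻¹ : Ω × Ω → Ω × Ω
  φ⟵⁻¹ = Inverse.from (⤖⇒↔ (mk⤖ φ⟵-bijective))
  φ⟶⁻¹ = Inverse.from (⤖⇒↔ (mk⤖ φ⟶-bijective))

  infix 7 _↶_ _◀_ _↷_ _▶_

  _↶_ _◀_ : Ω → Ω → Ω
  α ↶ β = proj₁ (φ⟵⁻¹ (α , β))
  α ◀ β = proj₂ (φ⟵⁻¹ (α , β))

  -- The arguments are swapped: φ⟶⁻¹ (α , β) is (β ▶ α , β ↷ α).
  _▶_ _↷_ : Ω → Ω → Ω
  β ▶ α = proj₁ (φ⟶⁻¹ (α , β))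
  β ↷ α = proj₂ (φ⟶⁻¹ (α , β))

{-# OPTIONS --safe #-}

-- Every claimed identity becomes visible after writing the variables as values
-- of φ⟵ and φ⟶ in three parameters: the axioms of an extended diassociative
-- semigroup exhibit each inner pair as a second value of φ⟵ or φ⟶, so that
-- injectivity evaluates all the products coming from φ⟵⁻¹ and φ⟶⁻¹.
module Submission where

open import Defs
open import Algebra.Definitions using (Associative)
open import Data.Product using (_×_; _,_; proj₁; proj₂)
open import Function.Bundles using (Inverse; mk⤖)
open import Function.Properties.Bijection using (⤖⇒↔)
open import Level using (Level)
open import Relation.Binary.PropositionalEquality
  using (_≡_; refl; sym; trans; cong; subst)

private
  variable
    a : Level

-- An indexed family rather than an existential: matching on `factor` replaces both variables by the
-- two values throughout the goal, so many later premises close by `refl`.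
data Factored {A : Set a} (f g : A → A → A) : A → A → Set a where
  factor : ∀ x y → Factored f g (f x y) (g x y)

module Products {E : ExtendedDiassociativeSemigroup a} (nd : Nondegenerate E) where
  open ExtendedDiassociativeSemigroup E
  open Nondegenerate nd

  private
    module L = Inverse (⤖⇒↔ (mk⤖ φ⟵-bijective))
    module R = Inverse (⤖⇒↔ (mk⤖ φ⟶-bijective))

  ⟵-factored : ∀ α β → Factored _⟵_ _◁_ α β
  ⟵-factored α β = subst (λ p → Factored _⟵_ _◁_ (proj₁ p) (proj₂ p))
    (L.strictlyInverseˡ (α , β)) (factor (α ↶ β) (α ◀ β))

  ⟶-factored : ∀ α β → Factored _⟶_ _▷_ α β
  ⟶-factored α β = subst (λ p → Factored _⟶_ _▷_ (proj₁ p) (proj₂ p))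
    (R.strictlyInverseˡ (α , β)) (factor (β ▶ α) (β ↷ α))

  -- Injectivity of `φ⟵`. The premises are equations so that a pair rewritten by the axioms can be
  -- evaluated without transport.
  ↶-unique : ∀ {α β x y} → α ≡ x ⟵ y → β ≡ x ◁ y → α ↶ β ≡ x
  ↶-unique refl refl = cong proj₁ (L.strictlyInverseʳ _)

  ◀-unique : ∀ {α β x y} → α ≡ x ⟵ y → β ≡ x ◁ y → α ◀ β ≡ y
  ◀-unique refl refl = cong proj₂ (L.strictlyInverseʳ _)

  ▶-unique : ∀ {α β x y} → α ≡ x ▷ y → β ≡ x ⟶ y → α ▶ β ≡ x
  ▶-unique refl refl = cong proj₁ (R.strictlyInverseʳ _)

  ↷-unique : ∀ {α β x y} → α ≡ x ▷ y → β ≡ x ⟶ y → α ↷ β ≡ y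
  ↷-unique refl refl = cong proj₂ (R.strictlyInverseʳ _)

  -- Besides `(β , α) = φ⟶ (x , u ⟵ v)`, the axioms give `(β , γ) = φ⟵ (x ⟶ u , v)`. The sides of
  -- the three equations evaluate to `u`, `x` and `v` in turn.
  ↷-↶-interchange : ∀ α β γ →
    ((α ↷ β) ↶ γ ≡ α ↷ (β ↶ γ)) ×
    (α ▶ (β ↶ γ) ≡ α ▶ β) ×
    ((α ↷ β) ◀ γ ≡ β ◀ γ)
  ↷-↶-interchange α β γ with ⟶-factored β α
  ... | factor x y with ⟵-factored y γ
  ... | factor u v =
      trans (↶-unique α↷β refl) (sym (↷-unique α≡ β↶γ))
    , trans (▶-unique α≡ β↶γ) (sym (▶-unique refl refl))
    , trans (◀-unique α↷β refl) (sym (◀-unique β≡ γ≡))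
    where
    α≡ = ▷-⟵ x u v
    β≡ = sym (⟶-⟵-assoc x u v)
    γ≡ = sym (⟶-◁ x u v)
    α↷β = ↷-unique refl refl
    β↶γ = ↶-unique β≡ γ≡

  -- With `w = (x ⟵ u) ◁ v`, the axioms give `(β , γ) = φ⟵ (x ◁ u , w)` and
  -- `(α , w) = φ⟵ (x ⟵ u , v)`. The common values are `v`, `x` and `u`.
  ◀-assoc-and-↶ : ∀ α β γ →
    (α ◀ (β ◀ γ) ≡ (α ◀ β) ◀ γ) ×
    ((α ↶ (β ◀ γ)) ↶ (β ↶ γ) ≡ α ↶ β) ×
    ((α ↶ (β ◀ γ)) ◀ (β ↶ γ) ≡ (α ◀ β) ↶ γ)
  ◀-assoc-and-↶ α β γ with ⟵-factored α β
  ... | factor x y with ⟵-factored y γ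
  ... | factor u v =
      trans (◀-unique α≡ β◀γ) (sym (◀-unique α◀β refl))
    , trans (↶-unique α↶β◀γ β↶γ) (sym (↶-unique refl refl))
    , trans (◀-unique α↶β◀γ β↶γ) (sym (↶-unique α◀β refl))
    where
    α≡ = sym (⟵-assoc x u v)
    β≡ = sym (◁-⟵-◁ x u v)
    γ≡ = sym (◁-◁-◁ x u v)
    α◀β = ◀-unique refl refl
    β◀γ = ◀-unique β≡ γ≡
    β↶γ = ↶-unique β≡ γ≡
    α↶β◀γ = ↶-unique α≡ β◀γ

  -- Mirror image of the previous argument: with `w = u ▷ (v ⟶ y)`, `(β , α) = φ⟶ (w , v ▷ y)` and
  -- `(γ , w) = φ⟶ (u , v ⟶ y)`. The common values are `u`, `y` and `v`.
  ▶-assoc-and-↷ : ∀ α β γ →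
    ((α ▶ β) ▶ γ ≡ α ▶ (β ▶ γ)) ×
    ((α ↷ β) ↷ ((α ▶ β) ↷ γ) ≡ β ↷ γ) ×
    ((α ↷ β) ▶ ((α ▶ β) ↷ γ) ≡ α ↷ (β ▶ γ))
  ▶-assoc-and-↷ α β γ with ⟶-factored γ β
  ... | factor x y with ⟶-factored x α
  ... | factor u v =
      trans (▶-unique α▶β γ≡) (sym (▶-unique refl β▶γ))
    , trans (↷-unique α↷β α▶β↷γ) (sym (↷-unique refl refl))
    , trans (▶-unique α↷β α▶β↷γ) (sym (↷-unique refl β▶γ))
    where
    α≡ = sym (▷-▷-▷ u v y)
    β≡ = sym (▷-⟶-▷ u v y)
    -- Two moves, because `⟶-assoc` starts from `(u ⟵ v) ⟶ y`, whereas `γ` is `(u ⟶ v) ⟶ y`.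
    γ≡ = trans (⟶-inner u v y) (⟶-assoc u v y)
    β▶γ = ▶-unique refl refl
    α▶β = ▶-unique α≡ β≡
    α↷β = ↷-unique α≡ β≡
    α▶β↷γ = ↷-unique α▶β γ≡

  -- Again `w = (x ⟵ u) ◁ v` and `(α , w) = φ⟵ (x ⟵ u , v)`, but the inner pair now belongs to the
  -- other bijection: `(γ , β) = φ⟶ (x ◁ u , w)`. The common values are `x`, `u` and `v`.
  ↶-↷-mixed : ∀ α β γ →
    ((α ↶ (β ↷ γ)) ↶ (β ▶ γ) ≡ α ↶ γ) ×
    ((α ↶ (β ↷ γ)) ◀ (β ▶ γ) ≡ β ▶ (α ◀ γ)) ×
    (β ↷ (α ◀ γ) ≡ α ◀ (β ↷ γ))
  ↶-↷-mixed α β γ with ⟵-factored α γ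
  ... | factor x y with ⟶-factored y β
  ... | factor u v =
      trans (↶-unique α↶β↷γ β▶γ) (sym (↶-unique refl refl))
    , trans (◀-unique α↶β↷γ β▶γ) (sym (▶-unique refl α◀γ))
    , trans (↷-unique refl α◀γ) (sym (◀-unique α≡ β↷γ))
    where
    α≡ = sym (trans (⟵-assoc x u v) (⟵-inner x u v))
    β≡ = sym (◁-▷-◁ x u v)
    γ≡ = sym (◁-⟶-◁ x u v)
    α◀γ = ◀-unique refl refl
    β▶γ = ▶-unique β≡ γ≡
    β↷γ = ↷-unique β≡ γ≡
    α↶β↷γ = ↶-unique α≡ β↷γ

  -- Mirror image: with `w = u ▷ (v ⟶ y)`, `(α , β) = φ⟵ (w , v ▷ y)` and
  -- `(γ , w) = φ⟶ (u , v ⟶ y)`. The common values are `y`, `v` and `u`.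
  ↷-↶-mixed : ∀ α β γ →
    ((α ◀ β) ↷ ((α ↶ β) ↷ γ) ≡ α ↷ γ) ×
    ((α ◀ β) ▶ ((α ↶ β) ↷ γ) ≡ (α ▶ γ) ◀ β) ×
    ((α ↶ β) ▶ γ ≡ (α ▶ γ) ↶ β)
  ↷-↶-mixed α β γ with ⟶-factored γ α
  ... | factor x y with ⟵-factored x β
  ... | factor u v =
      trans (↷-unique α◀β α↶β↷γ) (sym (↷-unique refl refl))
    , trans (▶-unique α◀β α↶β↷γ) (sym (◀-unique α▶γ refl))
    , trans (▶-unique α↶β γ≡) (sym (↶-unique α▶γ refl))
    where
    α≡ = sym (▷-⟵-▷ u v y)
    β≡ = sym (▷-◁-▷ u v y)
    γ≡ = ⟶-assoc u v y
    α▶γ = ▶-unique refl refl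
    α↶β = ↶-unique α≡ β≡
    α◀β = ◀-unique α≡ β≡
    α↶β↷γ = ↷-unique α↶β γ≡

proposition6 : ∀ {a} (E : ExtendedDiassociativeSemigroup a) (nd : Nondegenerate E) →
  let open ExtendedDiassociativeSemigroup E
      open Nondegenerate nd
  in
  (∀ (α β γ : Ω) →
      ((α ↷ β) ↶ γ ≡ α ↷ (β ↶ γ))
    × ((α ◀ (β ◀ γ) ≡ (α ◀ β) ◀ γ)
        × ((α ▶ β) ▶ γ ≡ α ▶ (β ▶ γ)))
    × ((α ▶ (β ↶ γ) ≡ α ▶ β)
        × ((α ↷ β) ◀ γ ≡ β ◀ γ))
    × (((α ↶ (β ◀ γ)) ↶ (β ↶ γ) ≡ α ↶ β)
        × ((α ↷ β) ↷ ((α ▶ β) ↷ γ) ≡ β ↷ γ))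
    × (((α ↶ (β ◀ γ)) ◀ (β ↶ γ) ≡ (α ◀ β) ↶ γ)
        × ((α ↷ β) ▶ ((α ▶ β) ↷ γ) ≡ α ↷ (β ▶ γ)))
    × (((α ↶ (β ↷ γ)) ↶ (β ▶ γ) ≡ α ↶ γ)
        × ((α ◀ β) ↷ ((α ↶ β) ↷ γ) ≡ α ↷ γ))
    × (((α ↶ (β ↷ γ)) ◀ (β ▶ γ) ≡ β ▶ (α ◀ γ))
        × ((α ◀ β) ▶ ((α ↶ β) ↷ γ) ≡ (α ▶ γ) ◀ β))
    × (((α ↶ β) ▶ γ ≡ (α ▶ γ) ↶ β)
        × (β ↷ (α ◀ γ) ≡ α ◀ (β ↷ γ))))
  × Associative _≡_ _◀_
  × Associative _≡_ _▶_
proposition6 E nd =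
    (λ α β γ →
      let (↷↶ , ▶-absorbs-↶ , ↷-absorbed-◀) = ↷-↶-interchange α β γ
          (◀-assoc , ↶↶ , ↶◀)              = ◀-assoc-and-↶ α β γ
          (▶-assoc , ↷↷ , ↷▶)              = ▶-assoc-and-↷ α β γ
          (↶↷↶ , ↶↷◀ , ↷◀)                 = ↶-↷-mixed α β γ
          (◀↶↷ , ◀↶▶ , ↶▶)                 = ↷-↶-mixed α β γ
      in  ↷↶
        , (◀-assoc , ▶-assoc)
        , (▶-absorbs-↶ , ↷-absorbed-◀)
        , (↶↶ , ↷↷)
        , (↶◀ , ↷▶)
        , (↶↷↶ , ◀↶↷)
        , (↶↷◀ , ◀↶▶)
        , (↶▶ , ↷◀))
  -- `Associative` has the left-nested product on its left, opposite to the identity proved for `◀`.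
  , (λ α β γ → sym (proj₁ (◀-assoc-and-↶ α β γ)))
  , (λ α β γ → proj₁ (▶-assoc-and-↷ α β γ))
  where open Products nd
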